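{- Every 2-tree is odd $4$-colorable.
   Context: All graphs are simple, finite and undirected. A $4$-coloring of a graph $G$ is a map $\varphi:V(G)\to\{1,2,3,4\}$ with $\varphi(u)\neq\varphi(v)$ for every edge $uv$. A vertex $v$ satisfies the odd condition with respect to $\varphi$ if $|\varphi^{ -1}(i)\cap N_G(v)|$ is odd for some color $i$. An odd $4$-coloring is a $4$-coloring in which every non-isolated vertex satisfies the odd condition. A graph $G$ is a 2-tree if there is a sequence $G_0,\dots,G_s$ of induced subgraphs of $G$ with $G_0\cong K_3$, $G_s=G$, and for each $i\in\{1,\dots,s\}$, $V(G_i)=V(G_{i-1})\cup\{x_i\}$ for a new vertex $x_i$ whose neighbors in $V(G_{i-1})$ form a clique of order $2$ (an edge) of $G$. -}

module Defs where

open import Data.Nat using (ℕ; suc; _%_)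
open import Data.Fin using (Fin; punchIn; _≟_)
open import Data.Bool using (Bool; true; false)
import Data.Bool as B
open import Data.List using (List; length; filter; allFin)
open import Data.Sum using (_⊎_)
open import Data.Product using (Σ; ∃; ∃-syntax; _×_; _,_)
open import Relation.Nullary using (¬_; _×-dec_)
open import Relation.Binary.PropositionalEquality using (_≡_; _≢_)

record Graph (n : ℕ) : Set where
  field
    adj   : Fin n → Fin n → Bool
    sym   : ∀ u v → adj u v ≡ adj v u
    irrefl : ∀ v → adj v v ≡ false
open Graph public

deleteVertex : ∀ {n} → Graph (suc n) → Fin (suc n) → Graph n
deleteVertex G x = record
  { adj    = λ u v → adj G (punchIn x u) (punchIn x v)
  ; sym    = λ u v → sym G (punchIn x u) (punchIn x v)
  ; irrefl = λ v → irrefl G (punchIn x v)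
  }

IsK3 : ∀ {n} → Graph n → Set
IsK3 {n} G = (n ≡ 3) × (∀ u v → u ≢ v → adj G u v ≡ true)

-- 2-trees: start from K3 and repeatedly add a new vertex whose neighbourhood
-- is exactly an edge (a clique of order 2) of the previous graph.
-- Equivalently (reading the sequence backwards), G is a 2-tree iff G ≅ K3
-- or G has a vertex x whose neighbours form exactly an edge {a,b} and G - x
-- is a 2-tree.
data IsTwoTree : ∀ {n} → Graph n → Set where
  base : ∀ {n} {G : Graph n} → IsK3 G → IsTwoTree G
  step : ∀ {n} {G : Graph (suc n)} (x a b : Fin (suc n)) →
         a ≢ b →
         adj G a b ≡ true →
         adj G x a ≡ true →
         adj G x b ≡ true →
         (∀ u → adj G x u ≡ true → (u ≡ a) ⊎ (u ≡ b)) →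
         IsTwoTree (deleteVertex G x) →
         IsTwoTree G

IsColoring : ∀ {n} → Graph n → (Fin n → Fin 4) → Set
IsColoring {n} G φ = ∀ u v → adj G u v ≡ true → φ u ≢ φ v

nbrColorCount : ∀ {n} → Graph n → (Fin n → Fin 4) → Fin n → Fin 4 → ℕ
nbrColorCount {n} G φ v i =
  length (filter (λ u → (adj G v u B.≟ true) ×-dec (φ u ≟ i)) (allFin n))

Odd : ℕ → Set
Odd m = m % 2 ≡ 1

NonIsolated : ∀ {n} → Graph n → Fin n → Set
NonIsolated G v = ∃[ u ] (adj G v u ≡ true)

OddCondition : ∀ {n} → Graph n → (Fin n → Fin 4) → Fin n → Set
OddCondition G φ v = ∃[ i ] Odd (nbrColorCount G φ v i)

IsOdd4Coloring : ∀ {n} → Graph n → (Fin n → Fin 4) → Set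
IsOdd4Coloring {n} G φ =
  IsColoring G φ × (∀ v → NonIsolated G v → OddCondition G φ v)

Odd4Colorable : ∀ {n} → Graph n → Set
Odd4Colorable {n} G = ∃[ φ ] IsOdd4Coloring G φ

{-# OPTIONS --safe #-}

-- Put a "gadget" on every edge uv: a list of pairs of parity vectors in F₂⁴,
-- the options for how many neighbours of each colour, mod 2, the edge uv and
-- whatever hangs off it contribute to u and to v.  One has to colour the graph
-- and choose an option on every edge so that the vectors chosen at each vertex
-- have a non-zero sum.  If x has only the two neighbours a and b, then x can be
-- deleted after replacing the gadget on ab by a new one, which absorbs those on
-- ab, ax and xb.  Starting from plain edges, only finitely many gadgets are
-- needed: there is a finite list of them such that every absorption contains a
-- member of the list.  Each member contains a pair of two non-zero vectors,
-- which solves the problem on K₂; and K₃ is K₂ with one vertex attached.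

module Submission where

open import Defs hiding (sym)
open import Algebra.Bundles using (CommutativeRing)
open import Data.Bool using (Bool; true; false; not; if_then_else_; _∧_; _xor_)
import Data.Bool as Bool
import Data.Bool.Properties as Boolₚ
open import Data.Empty using (⊥-elim)
open import Data.Fin using (Fin; zero; suc; punchIn; punchOut; _≟_)
open import Data.Fin.Patterns
open import Data.Fin.Permutation as Perm
  using (Permutation′; transpose; _∘ₚ_; _⟨$⟩ʳ_; _⟨$⟩ˡ_)
import Data.Fin.Permutation.Components as PC
open import Data.Fin.Properties
  using (any?; punchInᵢ≢i; punchIn-injective; punchIn-punchOut)
open import Data.List using
  (List; []; _∷_; _++_; length; filter; map; cartesianProduct; cartesianProductWith)
import Data.List as List
open import Data.List.Membership.Propositional using (_∈_; find)
open import Data.List.Membership.Propositional.Properties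
  using (∈-map⁺; ∈-map⁻; ∈-++⁺ˡ; ∈-++⁺ʳ; ∈-++⁻; ∈-filter⁻; ∈-cartesianProduct⁻;
         ∈-cartesianProductWith⁺; ∈-cartesianProductWith⁻)
import Data.List.Membership.DecPropositional as DecMembership
open import Data.List.Relation.Binary.Subset.Propositional using (_⊆_)
open import Data.List.Relation.Unary.All as All using (All)
open import Data.List.Relation.Unary.Any as Any using (Any; here)
open import Data.Nat using (ℕ; zero; suc)
open import Data.Product using (∃-syntax; ∃₂; _×_; _,_; proj₁; proj₂)
open import Data.Product.Properties using () renaming (≡-dec to ×-≡-dec)
open import Data.Sum using (_⊎_; inj₁; inj₂; [_,_]′)
open import Data.Vec using (Vec; []; _∷_; lookup; tabulate; zipWith)
open import Data.Vec.Functional using (Vector; insertAt; removeAt; updateAt)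
open import Data.Vec.Functional.Properties
  using (insertAt-lookup; insertAt-punchIn; updateAt-updates; updateAt-minimal)
open import Data.Vec.Properties
  using (lookup-zipWith; lookup∘tabulate; tabulate∘lookup; tabulate-cong)
  renaming (≡-dec to Vec-≡-dec)
open import Function using (_∘_; const)
open import Relation.Binary.Definitions using (DecidableEquality)
open import Relation.Binary.PropositionalEquality
open import Relation.Nullary using (Dec; does; yes; no; ¬_; _×-dec_)
open import Relation.Nullary.Decidable using (from-yes; map′; dec-true; dec-false)
open import Relation.Unary using (Decidable)

open import Algebra.Properties.CommutativeMonoid.Sum
  (CommutativeRing.+-commutativeMonoid Boolₚ.xor-∧-commutativeRing)
  using (sum; sum-remove; sum-cong-≗)

-- Gadgets and the operations on them.

Parities : Set
Parities = Vec Bool 4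

∅ ⟨0⟩ ⟨1⟩ ⟨2⟩ ⟨3⟩ ⟨02⟩ ⟨03⟩ ⟨12⟩ ⟨13⟩ ⟨23⟩ ⟨023⟩ ⟨123⟩ : Parities
∅     = false ∷ false ∷ false ∷ false ∷ []
⟨0⟩   = true ∷ false ∷ false ∷ false ∷ []
⟨1⟩   = false ∷ true ∷ false ∷ false ∷ []
⟨2⟩   = false ∷ false ∷ true ∷ false ∷ []
⟨3⟩   = false ∷ false ∷ false ∷ true ∷ []
⟨02⟩  = true ∷ false ∷ true ∷ false ∷ []
⟨03⟩  = true ∷ false ∷ false ∷ true ∷ []
⟨12⟩  = false ∷ true ∷ true ∷ false ∷ []
⟨13⟩  = false ∷ true ∷ false ∷ true ∷ []
⟨23⟩  = false ∷ false ∷ true ∷ true ∷ []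
⟨023⟩ = true ∷ false ∷ true ∷ true ∷ []
⟨123⟩ = false ∷ true ∷ true ∷ true ∷ []

infix 6 _∣_

_∣_ : Parities → Parities → Parities × Parities
_∣_ = _,_

-- The options are recorded for the end colours 0 and 1, in this order; any other
-- colouring of the ends is reached by a permutation of the colours.
Gadget : Set
Gadget = List (Parities × Parities)

infixl 6 _⊕_ _⊞_

_⊕_ : Parities → Parities → Parities
_⊕_ = zipWith _xor_

Odd∈ : Parities → Set
Odd∈ p = ∃[ i ] lookup p i ≡ true

odd∈? : Decidable Odd∈
odd∈? p = any? (λ i → lookup p i Bool.≟ true)

-- Vectors are pulled back: `τ` leads from the colours in use to the recorded ones, so colour `i`
-- inherits the recorded parity of its image.
recolour : Permutation′ 4 → Parities → Parities
recolour τ p = tabulate (λ i → lookup p (τ ⟨$⟩ʳ i))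

recolour₂ : Permutation′ 4 → Parities × Parities → Parities × Parities
recolour₂ τ (p , q) = recolour τ p , recolour τ q

-- Exchanging the ends alone would leave the first end with colour 1, so the colours 0 and 1 are
-- exchanged too, which restores the normal form.
reverse : Parities × Parities → Parities × Parities
reverse (p , q) = recolour (transpose 0F 1F) q , recolour (transpose 0F 1F) p

flip : Gadget → Gadget
flip = map reverse

-- Two gadgets in parallel on one edge: the choices are independent and their contributions add up.
_⊞_ : Gadget → Gadget → Gadget
_⊞_ = cartesianProductWith (λ (p , q) (r , s) → p ⊕ r , q ⊕ s)

-- `r` and `s` are what the two sides contribute to the apex. The apex has no other edges, so its
-- odd condition is settled here, and `wedge` can then forget both vectors.
Compatible : (Parities × Parities) × (Parities × Parities) → Set
Compatible ((_ , r) , (s , _)) = Odd∈ (r ⊕ s)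

compatible? : Decidable Compatible
compatible? ((_ , r) , (s , _)) = odd∈? (r ⊕ s)

-- In a triangle whose base ends have colours 0 and 1, the apex has colour 2 or 3.
-- The transpositions below carry the end colours (0,1) of a side's gadget to
-- (0, apex) and (apex, 1).
apex : Fin 2 → Fin 4
apex k = suc (suc k)

wedge : Fin 2 → Gadget → Gadget → Gadget
wedge k E F = map (λ ((p , _) , (_ , q)) → p , q) (filter compatible?
  (cartesianProduct (map (recolour₂ (transpose 1F (apex k))) E)
                    (map (recolour₂ (transpose 0F (apex k))) F)))

triangle : Gadget → Gadget → Gadget
triangle E F = wedge 0F E F ++ wedge 1F E F

∈-wedge⁻ : ∀ k E F {p q} → (p , q) ∈ wedge k E F →
  ∃₂ λ r s → ∃₂ λ r′ s′ → (r , s) ∈ E × (r′ , s′) ∈ F ×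
    p ≡ recolour (transpose 1F (apex k)) r ×
    q ≡ recolour (transpose 0F (apex k)) s′ ×
    Odd∈ (recolour (transpose 1F (apex k)) s ⊕ recolour (transpose 0F (apex k)) r′)
∈-wedge⁻ k E F pq∈ with ∈-map⁻ _ pq∈
... | _ , ef∈ , refl with ∈-filter⁻ compatible? ef∈
... | ef∈′ , odd with ∈-cartesianProduct⁻ (map _ E) (map _ F) ef∈′
... | e∈ , f∈ with ∈-map⁻ _ e∈ | ∈-map⁻ _ f∈
... | (r , s) , rs∈ , refl | (r′ , s′) , rs∈′ , refl =
  r , s , r′ , s′ , rs∈ , rs∈′ , refl , refl , odd

∈-triangle⁻ : ∀ E F {p q} → (p , q) ∈ triangle E F → ∃[ k ] (p , q) ∈ wedge k E F
∈-triangle⁻ E F pq∈ with ∈-++⁻ (wedge 0F E F) pq∈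
... | inj₁ pq∈′ = 0F , pq∈′
... | inj₂ pq∈′ = 1F , pq∈′

-- Colour permutations and realised options.

recolour-lookup : ∀ τ p i → lookup (recolour τ p) i ≡ lookup p (τ ⟨$⟩ʳ i)
recolour-lookup τ p i = lookup∘tabulate (λ i → lookup p (τ ⟨$⟩ʳ i)) i

recolour-recolour : ∀ σ τ p → recolour σ (recolour τ p) ≡ recolour (σ ∘ₚ τ) p
recolour-recolour σ τ p = tabulate-cong λ i → recolour-lookup τ p (σ ⟨$⟩ʳ i)

Vec-ext : ∀ {n} {A : Set} {p q : Vec A n} → (∀ i → lookup p i ≡ lookup q i) → p ≡ q
Vec-ext {p = p} {q} eq =
  trans (sym (tabulate∘lookup p)) (trans (tabulate-cong eq) (tabulate∘lookup q))

recolour-⊕ : ∀ τ p q → recolour τ (p ⊕ q) ≡ recolour τ p ⊕ recolour τ q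
recolour-⊕ τ p q = Vec-ext λ i → begin
  lookup (recolour τ (p ⊕ q)) i                          ≡⟨ recolour-lookup τ (p ⊕ q) i ⟩
  lookup (p ⊕ q) (τ ⟨$⟩ʳ i)                              ≡⟨ lookup-zipWith _xor_ (τ ⟨$⟩ʳ i) p q ⟩
  lookup p (τ ⟨$⟩ʳ i) xor lookup q (τ ⟨$⟩ʳ i)            ≡⟨ cong₂ _xor_ (recolour-lookup τ p i) (recolour-lookup τ q i) ⟨
  lookup (recolour τ p) i xor lookup (recolour τ q) i    ≡⟨ lookup-zipWith _xor_ i (recolour τ p) (recolour τ q) ⟨
  lookup (recolour τ p ⊕ recolour τ q) i                 ∎
  where open ≡-Reasoning

recolour-odd : ∀ τ p → Odd∈ p → Odd∈ (recolour τ p)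
recolour-odd τ p (i , eq) = τ ⟨$⟩ˡ i ,
  trans (recolour-lookup τ p _) (trans (cong (lookup p) (Perm.inverseʳ τ)) eq)

-- `p` and `q` are the contributions in the actual colouring, where the ends have colours `c` and
-- `d`; `τ` translates back to the normal form. Either bijection of the other two colours onto 2 and
-- 3 is allowed.
record Realises (E : Gadget) (c d : Fin 4) (p q : Parities) : Set where
  constructor realise
  field
    τ       : Permutation′ 4
    c↦0     : τ ⟨$⟩ʳ c ≡ 0F
    d↦1     : τ ⟨$⟩ʳ d ≡ 1F
    {r s}   : Parities
    rs∈E    : (r , s) ∈ E
    p≡      : p ≡ recolour τ r
    q≡      : q ≡ recolour τ s

-- Properness of the colouring comes from here: a solution does not impose it separately.
realises-≢ : ∀ {E c d p q} → Realises E c d p q → c ≢ d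
realises-≢ (realise τ c↦0 d↦1 _ _ _) refl with () ← trans (sym c↦0) d↦1

recolour-transpose : ∀ τ i j p →
  recolour τ p ≡ recolour (τ ∘ₚ transpose i j) (recolour (transpose j i) p)
recolour-transpose τ i j p = sym (trans (recolour-recolour (τ ∘ₚ transpose i j) (transpose j i) p)
  (tabulate-cong λ k → cong (lookup p) (PC.transpose-inverse j i {τ ⟨$⟩ʳ k})))

realises-flip : ∀ {E c d p q} → Realises E c d p q → Realises (flip E) d c q p
realises-flip (realise τ c↦0 d↦1 {r} {s} rs∈E p≡ q≡) = realise
  (τ ∘ₚ transpose 1F 0F)
  (cong (PC.transpose 1F 0F) d↦1) (cong (PC.transpose 1F 0F) c↦0)
  (∈-map⁺ reverse rs∈E)
  (trans q≡ (recolour-transpose τ 1F 0F s))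
  (trans p≡ (recolour-transpose τ 1F 0F r))

reverse-involutive : ∀ pq → reverse (reverse pq) ≡ pq
reverse-involutive (_ ∷ _ ∷ _ ∷ _ ∷ [] , _ ∷ _ ∷ _ ∷ _ ∷ []) = refl

flip-involutive : ∀ E → flip (flip E) ≡ E
flip-involutive []       = refl
flip-involutive (pq ∷ E) = cong₂ _∷_ (reverse-involutive pq) (flip-involutive E)

transpose-apex-1 : ∀ k → PC.transpose 1F (apex k) (apex k) ≡ 1F
transpose-apex-1 0F = refl
transpose-apex-1 1F = refl

transpose-apex-0 : ∀ k → PC.transpose 0F (apex k) (apex k) ≡ 0F
transpose-apex-0 0F = refl
transpose-apex-0 1F = refl

-- The data for putting back a vertex between ends coloured `c` and `d`: its colour, the
-- contributions `s` and `r′` it receives from its two sides, and its own odd condition.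
record Ear (E F : Gadget) (c d : Fin 4) (p q : Parities) : Set where
  field
    colour     : Fin 4
    s r′       : Parities
    realisesˡ  : Realises E c colour p s
    realisesʳ  : Realises F colour d r′ q
    odd        : Odd∈ (s ⊕ r′)

-- The apex receives the colour that `τ` sends to 2 or 3. Following `τ` by the transposition used in
-- `wedge` normalises the end colours of each side, and permuting colours keeps a vector non-zero.
realises-triangle : ∀ {E F c d p q} → Realises (triangle E F) c d p q → Ear E F c d p q
realises-triangle {E} {F} (realise τ c↦0 d↦1 pq∈ refl refl) with ∈-triangle⁻ E F pq∈
... | k , pq∈′ with ∈-wedge⁻ k E F pq∈′
... | r , s , r′ , s′ , rs∈ , rs∈′ , refl , refl , odd = record
  { colour    = τ ⟨$⟩ˡ apex k
  ; realisesˡ = realise (τ ∘ₚ transpose 1F (apex k))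
                  (cong (PC.transpose 1F (apex k)) c↦0)
                  (trans (cong (PC.transpose 1F (apex k)) (Perm.inverseʳ τ)) (transpose-apex-1 k))
                  rs∈ (recolour-recolour τ (transpose 1F (apex k)) r) refl
  ; realisesʳ = realise (τ ∘ₚ transpose 0F (apex k))
                  (trans (cong (PC.transpose 0F (apex k)) (Perm.inverseʳ τ)) (transpose-apex-0 k))
                  (cong (PC.transpose 0F (apex k)) d↦1)
                  rs∈′ refl (recolour-recolour τ (transpose 0F (apex k)) s′)
  ; odd       = subst Odd∈
                  (trans (recolour-⊕ τ (recolour (transpose 1F (apex k)) s)
                                       (recolour (transpose 0F (apex k)) r′))
                    (cong₂ _⊕_ (recolour-recolour τ (transpose 1F (apex k)) s)
                               (recolour-recolour τ (transpose 0F (apex k)) r′)))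
                  (recolour-odd τ (recolour (transpose 1F (apex k)) s ⊕ recolour (transpose 0F (apex k)) r′)
                    odd)
  }

realises-⊞ : ∀ {E T c d p q} → Realises (E ⊞ T) c d p q →
  ∃₂ λ p₁ q₁ → ∃₂ λ p₂ q₂ → Realises E c d p₁ q₁ × Realises T c d p₂ q₂ ×
    p ≡ p₁ ⊕ p₂ × q ≡ q₁ ⊕ q₂
realises-⊞ {E} {T} (realise τ c↦0 d↦1 pq∈ refl refl) with ∈-cartesianProductWith⁻ _ E T pq∈
... | (p , q) , (r , s) , pq∈′ , rs∈ , refl =
  _ , _ , _ , _ , realise τ c↦0 d↦1 pq∈′ refl refl , realise τ c↦0 d↦1 rs∈ refl refl ,
  recolour-⊕ τ p r , recolour-⊕ τ q s

realises-⊆ : ∀ {E F c d p q} → E ⊆ F → Realises E c d p q → Realises F c d p q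
realises-⊆ E⊆F (realise τ c↦0 d↦1 rs∈ p≡ q≡) = realise τ c↦0 d↦1 (E⊆F rs∈) p≡ q≡

-- Sums over the field with two elements.

sum-change : ∀ {n} (f g : Vector Bool n) k → (∀ u → u ≢ k → f u ≡ g u) →
  sum f ≡ (f k xor g k) xor sum g
sum-change {suc n} f g k eq = begin
  sum f                                             ≡⟨ sum-remove f ⟩
  f k xor sum (removeAt f k)                        ≡⟨ cong (f k xor_) (sum-cong-≗ λ j → eq (punchIn k j) (punchInᵢ≢i k j)) ⟩
  f k xor sum (removeAt g k)                        ≡⟨ cancel (f k) (g k) (sum (removeAt g k)) ⟩
  (f k xor g k) xor (g k xor sum (removeAt g k))    ≡⟨ cong ((f k xor g k) xor_) (sum-remove g) ⟨
  (f k xor g k) xor sum g                           ∎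
  where
  open ≡-Reasoning
  cancel : ∀ x y z → x xor z ≡ (x xor y) xor (y xor z)
  cancel true  true  z = refl
  cancel true  false z = refl
  cancel false true  z = sym (Boolₚ.not-involutive z)
  cancel false false z = refl

sum-false : ∀ {n} (f : Vector Bool n) → (∀ u → f u ≡ false) → sum f ≡ false
sum-false {zero}  f eq = refl
sum-false {suc n} f eq = cong₂ _xor_ (eq zero) (sum-false (f ∘ suc) (eq ∘ suc))

-- `sum-change` is used twice: first to clear the value at `a`, then to compare the result with the
-- zero function at `b`.
sum-pair : ∀ {n} (f : Vector Bool n) {a b} → a ≢ b → (∀ u → u ≢ a → u ≢ b → f u ≡ false) →
  sum f ≡ f a xor f b
sum-pair {n} f {a} {b} a≢b eq = begin
  sum f                               ≡⟨ sum-change f f∖a a f≗f∖a ⟩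
  (f a xor f∖a a) xor sum f∖a         ≡⟨ cong₂ (λ x y → (f a xor x) xor y) f∖a-a (sum-change f∖a (const false) b f∖a-b) ⟩
  (f a xor false) xor ((f∖a b xor false) xor sum {n} (const false))
    ≡⟨ cong₂ (λ x y → (f a xor false) xor ((x xor false) xor y)) (sym (f≗f∖a b (a≢b ∘ sym))) (sum-false {n} (const false) λ _ → refl) ⟩
  (f a xor false) xor ((f b xor false) xor false)
    ≡⟨ cong₂ _xor_ (Boolₚ.xor-identityʳ (f a)) (trans (Boolₚ.xor-identityʳ _) (Boolₚ.xor-identityʳ (f b))) ⟩
  f a xor f b ∎
  where
  open ≡-Reasoning
  f∖a : Vector Bool n
  f∖a u = if does (u ≟ a) then false else f u
  f≗f∖a : ∀ u → u ≢ a → f u ≡ f∖a u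
  f≗f∖a u u≢a rewrite dec-false (u ≟ a) u≢a = refl
  f∖a-a : f∖a a ≡ false
  f∖a-a rewrite dec-true (a ≟ a) refl = refl
  f∖a-b : ∀ u → u ≢ b → f∖a u ≡ false
  f∖a-b u u≢b with u ≟ a
  ... | yes _  = refl
  ... | no u≢a = eq u u≢a u≢b

-- Edge data as matrices: changing one edge, adding one vertex.

module _ {n} {A : Set} (f : Fin n → Fin n → A) (a b : Fin n) (y z : A) where

  -- The pair `(a , b)` is tested first and would win if the two ends coincided; hence the
  -- hypothesis `a ≢ b` in `override-ba`.
  override : Fin n → Fin n → A
  override u v =
    if does (u ≟ a ×-dec v ≟ b) then y else
    if does (u ≟ b ×-dec v ≟ a) then z else f u v

  override-ab : override a b ≡ y
  override-ab rewrite dec-true (a ≟ a ×-dec b ≟ b) (refl , refl) = refl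

  override-ba : a ≢ b → override b a ≡ z
  override-ba a≢b
    rewrite dec-false (b ≟ a ×-dec a ≟ b) (a≢b ∘ proj₂)
          | dec-true (b ≟ b ×-dec a ≟ a) (refl , refl) = refl

  override-other : ∀ {u v} → ¬ (u ≡ a × v ≡ b) → ¬ (u ≡ b × v ≡ a) → override u v ≡ f u v
  override-other {u} {v} ¬ab ¬ba
    rewrite dec-false (u ≟ a ×-dec v ≟ b) ¬ab | dec-false (u ≟ b ×-dec v ≟ a) ¬ba = refl

data Position {n} (a b : Fin n) : Fin n → Fin n → Set where
  ab    : Position a b a b
  ba    : Position a b b a
  other : ∀ {u v} → ¬ (u ≡ a × v ≡ b) → ¬ (u ≡ b × v ≡ a) → Position a b u v

position : ∀ {n} (a b u v : Fin n) → Position a b u v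
position a b u v with u ≟ a ×-dec v ≟ b | u ≟ b ×-dec v ≟ a
... | yes (refl , refl) | _                 = ab
... | no _              | yes (refl , refl) = ba
... | no ¬ab            | no ¬ba            = other ¬ab ¬ba

module _ {n} {A : Set} (x : Fin (suc n)) (f : Fin n → Fin n → A) (row col : Fin n → A) (z : A) where

  border : Fin (suc n) → Fin (suc n) → A
  border = insertAt (λ u → insertAt (f u) x (col u)) x (insertAt row x z)

  border-inner : ∀ u v → border (punchIn x u) (punchIn x v) ≡ f u v
  border-inner u v = trans
    (cong-app (insertAt-punchIn (λ u → insertAt (f u) x (col u)) x (insertAt row x z) u) (punchIn x v))
    (insertAt-punchIn (f u) x (col u) v)

  border-col : ∀ u → border (punchIn x u) x ≡ col u
  border-col u = trans
    (cong-app (insertAt-punchIn (λ u → insertAt (f u) x (col u)) x (insertAt row x z) u) x)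
    (insertAt-lookup (f u) x (col u))

  border-row : ∀ v → border x (punchIn x v) ≡ row v
  border-row v = trans
    (cong-app (insertAt-lookup (λ u → insertAt (f u) x (col u)) x (insertAt row x z)) (punchIn x v))
    (insertAt-punchIn row x z v)

data PunchInView {n} (x : Fin (suc n)) : Fin (suc n) → Set where
  hole  : PunchInView x x
  punch : ∀ u → PunchInView x (punchIn x u)

punchInView : ∀ {n} (x u : Fin (suc n)) → PunchInView x u
punchInView x u with x ≟ u
... | yes refl = hole
... | no x≢u   = subst (PunchInView x) (punchIn-punchOut x≢u) (punch (punchOut x≢u))

-- Gadget problems and their solutions.

total : ∀ {n} → Graph n → (Fin n → Fin n → Parities) → Fin n → Vector Bool 4
total G p v i = sum (λ u → adj G v u ∧ lookup (p v u) i)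

-- `p v u` is what the edge `vu` contributes to `v`. It is defined for all pairs, and `total` masks
-- the non-edges.
record Solution {n} (G : Graph n) (t : Fin n → Fin n → Gadget) : Set where
  field
    φ        : Fin n → Fin 4
    p        : Fin n → Fin n → Parities
    realises : ∀ u v → adj G u v ≡ true → Realises (t u v) (φ u) (φ v) (p u v) (p v u)
    odd      : ∀ v → ∃[ i ] total G p v i ≡ true

-- What the induction asks of a set of gadgets. Containment suffices in `absorb-good`, because a
-- choice from fewer options is also a choice from more.
record GoodClass (Good : Gadget → Set) : Set where
  field
    flip-good   : ∀ {E} → Good E → Good (flip E)
    absorb-good : ∀ {E F H} → Good E → Good F → Good H →
                  ∃[ E′ ] Good E′ × E′ ⊆ E ⊞ triangle F H
    odd-pair    : ∀ {E} → Good E → ∃₂ λ p q → (p , q) ∈ E × Odd∈ p × Odd∈ q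

-- All good assignments are allowed, since deleting a vertex puts a new gadget on an edge even if
-- only plain edges were present before. Each edge stores its gadget in both directions.
Solvable : (Good : Gadget → Set) → ∀ {n} → Graph n → Set
Solvable Good {n} G = (t : Fin n → Fin n → Gadget) → (∀ u v → Good (t u v)) →
  (∀ u v → t v u ≡ flip (t u v)) → Solution G t

realises-≡ : ∀ {E F c d p q} → E ≡ F → Realises E c d p q → Realises F c d p q
realises-≡ refl r = r

realises-sym : ∀ {n} {t : Fin n → Fin n → Gadget} {u v c d p q} →
  (∀ u v → t v u ≡ flip (t u v)) → Realises (t u v) c d p q → Realises (t v u) d c q p
realises-sym {u = u} {v} t-sym r =
  realises-≡ (sym (t-sym u v)) (realises-flip r)

realises-cong : ∀ {E c c′ d d′ p p′ q q′} → c ≡ c′ → d ≡ d′ → p ≡ p′ → q ≡ q′ →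
  Realises E c d p q → Realises E c′ d′ p′ q′
realises-cong refl refl refl refl r = r

-- Putting back a vertex of degree two.

module _ {n} (G : Graph (suc n)) (x : Fin (suc n)) {a b : Fin n} (a≢b : a ≢ b)
  (a~b : adj (deleteVertex G x) a b ≡ true)
  (x~a : adj G x (punchIn x a) ≡ true)
  (x~b : adj G x (punchIn x b) ≡ true)
  (x~ : ∀ u → adj G x (punchIn x u) ≡ true → u ≡ a ⊎ u ≡ b) where

  private
    G⁻ : Graph n
    G⁻ = deleteVertex G x

    inner : (Fin (suc n) → Fin (suc n) → Gadget) → Fin n → Fin n → Gadget
    inner t u v = t (punchIn x u) (punchIn x v)

  module _ {t : Fin (suc n) → Fin (suc n) → Gadget} (t-sym : ∀ u v → t v u ≡ flip (t u v))
    {E : Gadget} (S : Solution G⁻ (override (inner t) a b E (flip E))) where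

    open Solution S renaming (φ to φ⁻; p to p⁻; realises to realises⁻; odd to odd⁻)

    -- The vectors on `ab` split into a part `p₁`, `q₁` from the old gadget, which stays on `ab`,
    -- and a part `p₂`, `q₂` from the ear, which moves to the edges `ax` and `bx`.
    module Insert {p₁ q₁ p₂ q₂ : Parities}
      (r₁ : Realises (inner t a b) (φ⁻ a) (φ⁻ b) p₁ q₁)
      (ear : Ear (t (punchIn x a) x) (t x (punchIn x b)) (φ⁻ a) (φ⁻ b) p₂ q₂)
      (p-split : p⁻ a b ≡ p₁ ⊕ p₂) (q-split : p⁻ b a ≡ q₁ ⊕ q₂) where

      open Ear ear using (colour; s; r′; realisesˡ; realisesʳ) renaming (odd to s⊕r′-odd)

      φ : Fin (suc n) → Fin 4
      φ = insertAt φ⁻ x colour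

      φ-x : φ x ≡ colour
      φ-x = insertAt-lookup φ⁻ x colour

      φ-inner : ∀ u → φ (punchIn x u) ≡ φ⁻ u
      φ-inner = insertAt-punchIn φ⁻ x colour

      p↓ : Fin n → Fin n → Parities
      p↓ = override p⁻ a b p₁ q₁

      -- `row` lists the contributions to `x`, and `col` those from the edges at `x` to the other
      -- ends. The constants are the values meant for `b`; away from `a` and `b` they are defaults
      -- at non-edges.
      row col : Fin n → Parities
      row = updateAt (const r′) a (const s)
      col = updateAt (const q₂) a (const p₂)

      row-a : row a ≡ s
      row-a = updateAt-updates a (const r′)
      row-b : row b ≡ r′
      row-b = updateAt-minimal b a (const r′) (a≢b ∘ sym)
      col-a : col a ≡ p₂
      col-a = updateAt-updates a (const q₂)
      col-b : col b ≡ q₂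
      col-b = updateAt-minimal b a (const q₂) (a≢b ∘ sym)

      p : Fin (suc n) → Fin (suc n) → Parities
      -- The corner `s` is a default, masked because `x` has no loop.
      p = border x p↓ row col s

      p-inner : ∀ u v → p (punchIn x u) (punchIn x v) ≡ p↓ u v
      p-inner = border-inner x p↓ row col s
      p-row : ∀ v → p x (punchIn x v) ≡ row v
      p-row = border-row x p↓ row col s
      p-col : ∀ u → p (punchIn x u) x ≡ col u
      p-col = border-col x p↓ row col s

      realises-x : ∀ v → adj G x (punchIn x v) ≡ true →
        Realises (t x (punchIn x v)) (φ x) (φ (punchIn x v)) (p x (punchIn x v)) (p (punchIn x v) x)
      realises-x v x~v with x~ v x~v
      ... | inj₁ refl = realises-cong (sym φ-x) (sym (φ-inner a))
        (sym (trans (p-row a) row-a)) (sym (trans (p-col a) col-a)) (realises-sym t-sym realisesˡ)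
      ... | inj₂ refl = realises-cong (sym φ-x) (sym (φ-inner b))
        (sym (trans (p-row b) row-b)) (sym (trans (p-col b) col-b)) realisesʳ

      realises↓ : ∀ u v → adj G⁻ u v ≡ true → Realises (inner t u v) (φ⁻ u) (φ⁻ v) (p↓ u v) (p↓ v u)
      realises↓ u v u~v with position a b u v
      ... | ab = realises-cong refl refl
        (sym (override-ab p⁻ a b p₁ q₁)) (sym (override-ba p⁻ a b p₁ q₁ a≢b)) r₁
      ... | ba = realises-cong refl refl
        (sym (override-ba p⁻ a b p₁ q₁ a≢b)) (sym (override-ab p⁻ a b p₁ q₁)) (realises-sym t-sym r₁)
      ... | other ¬ab ¬ba = realises-cong refl refl
        (sym (override-other p⁻ a b p₁ q₁ ¬ab ¬ba))
        (sym (override-other p⁻ a b p₁ q₁ (λ (v≡a , u≡b) → ¬ba (u≡b , v≡a)) (λ (v≡b , u≡a) → ¬ab (u≡a , v≡b))))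
        (realises-≡ (override-other (inner t) a b E (flip E) ¬ab ¬ba) (realises⁻ u v u~v))

      realises : ∀ u v → adj G u v ≡ true → Realises (t u v) (φ u) (φ v) (p u v) (p v u)
      realises u v u~v with punchInView x u | punchInView x v
      ... | hole | hole with () ← trans (sym u~v) (irrefl G x)
      ... | hole | punch v = realises-x v u~v
      ... | punch u | hole = realises-sym t-sym (realises-x u (trans (Graph.sym G _ _) u~v))
      ... | punch u | punch v = realises-cong (sym (φ-inner u)) (sym (φ-inner v))
        (sym (p-inner u v)) (sym (p-inner v u)) (realises↓ u v u~v)

      open ≡-Reasoning

      not-adjacent : ∀ {u} → u ≢ a → u ≢ b → adj G x (punchIn x u) ≡ false
      not-adjacent {u} u≢a u≢b with adj G x (punchIn x u) in eq
      ... | false = refl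
      ... | true  = ⊥-elim ([ u≢a , u≢b ]′ (x~ u eq))

      total-x : ∀ i → total G p x i ≡ lookup (s ⊕ r′) i
      total-x i = begin
        total G p x i                                           ≡⟨ sum-remove {i = x} (λ u → adj G x u ∧ lookup (p x u) i) ⟩
        (adj G x x ∧ lookup (p x x) i) xor sum f                ≡⟨ cong (λ y → (y ∧ lookup (p x x) i) xor sum f) (irrefl G x) ⟩
        sum f                                                   ≡⟨ sum-pair f a≢b (λ u u≢a u≢b →
          cong (_∧ lookup (p x (punchIn x u)) i) (not-adjacent u≢a u≢b)) ⟩
        f a xor f b                                             ≡⟨ cong₂ _xor_ (f-≡ x~a row-a) (f-≡ x~b row-b) ⟩
        lookup s i xor lookup r′ i                              ≡⟨ lookup-zipWith _xor_ i s r′ ⟨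
        lookup (s ⊕ r′) i                                       ∎
        where
        f : Vector Bool n
        f u = adj G x (punchIn x u) ∧ lookup (p x (punchIn x u)) i
        f-≡ : ∀ {u r} → adj G x (punchIn x u) ≡ true → row u ≡ r → f u ≡ lookup r i
        f-≡ {u} x~u eq = cong₂ (λ y z → y ∧ lookup z i) x~u (trans (p-row u) eq)

      total-inner : ∀ v i → total G p (punchIn x v) i ≡
        (adj G (punchIn x v) x ∧ lookup (col v) i) xor total G⁻ p↓ v i
      total-inner v i = trans
        (sum-remove {i = x} (λ u → adj G (punchIn x v) u ∧ lookup (p (punchIn x v) u) i))
        (cong₂ (λ y z → (adj G (punchIn x v) x ∧ lookup y i) xor z) (p-col v)
          (sum-cong-≗ λ u → cong (λ y → adj G⁻ v u ∧ lookup y i) (p-inner v u)))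

      cancel : ∀ y z w → z xor ((y xor (y xor z)) xor w) ≡ w
      cancel true  true  true  = refl
      cancel true  true  false = refl
      cancel true  false w = refl
      cancel false true  true  = refl
      cancel false true  false = refl
      cancel false false w = refl

      -- At an end `v` of the base edge `vw`, the vector `y ⊕ z` on that edge shrinks to `y`, while
      -- the new edge to `x` brings `z`; modulo 2 the two changes cancel.
      total-end : ∀ {v w y z} → adj G x (punchIn x v) ≡ true → adj G⁻ v w ≡ true →
        col v ≡ z → p↓ v w ≡ y → p⁻ v w ≡ y ⊕ z → (∀ u → u ≢ w → p↓ v u ≡ p⁻ v u) →
        ∀ i → total G p (punchIn x v) i ≡ total G⁻ p⁻ v i
      total-end {v} {w} {y} {z} x~v v~w col≡ p↓≡ p⁻≡ same i = begin
        total G p (punchIn x v) i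
          ≡⟨ total-inner v i ⟩
        (adj G (punchIn x v) x ∧ lookup (col v) i) xor total G⁻ p↓ v i
          ≡⟨ cong₂ _xor_ (cong₂ (λ c r → c ∧ lookup r i) (trans (Graph.sym G _ _) x~v) col≡)
               (sum-change _ _ w (λ u u≢w → cong (λ r → adj G⁻ v u ∧ lookup r i) (same u u≢w))) ⟩
        lookup z i xor (((adj G⁻ v w ∧ lookup (p↓ v w) i) xor (adj G⁻ v w ∧ lookup (p⁻ v w) i)) xor total G⁻ p⁻ v i)
          ≡⟨ cong (λ c → lookup z i xor (((c ∧ lookup (p↓ v w) i) xor (c ∧ lookup (p⁻ v w) i)) xor total G⁻ p⁻ v i)) v~w ⟩
        lookup z i xor ((lookup (p↓ v w) i xor lookup (p⁻ v w) i) xor total G⁻ p⁻ v i)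
          ≡⟨ cong₂ (λ c d → lookup z i xor ((c xor d) xor total G⁻ p⁻ v i)) (cong (λ r → lookup r i) p↓≡)
               (trans (cong (λ r → lookup r i) p⁻≡) (lookup-zipWith _xor_ i y z)) ⟩
        lookup z i xor ((lookup y i xor (lookup y i xor lookup z i)) xor total G⁻ p⁻ v i)
          ≡⟨ cancel (lookup y i) (lookup z i) (total G⁻ p⁻ v i) ⟩
        total G⁻ p⁻ v i ∎

      total-≡ : ∀ v i → total G p (punchIn x v) i ≡ total G⁻ p⁻ v i
      total-≡ v i with v ≟ a | v ≟ b
      ... | yes refl | _ = total-end x~a a~b col-a (override-ab p⁻ a b p₁ q₁) p-split
        (λ u u≢b → override-other p⁻ a b p₁ q₁ (u≢b ∘ proj₂) (a≢b ∘ proj₁)) i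
      ... | no _ | yes refl = total-end x~b (trans (Graph.sym G _ _) a~b) col-b (override-ba p⁻ a b p₁ q₁ a≢b) q-split
        (λ u u≢a → override-other p⁻ a b p₁ q₁ (a≢b ∘ sym ∘ proj₁) (u≢a ∘ proj₂)) i
      ... | no v≢a | no v≢b = begin
        total G p (punchIn x v) i
          ≡⟨ total-inner v i ⟩
        (adj G (punchIn x v) x ∧ lookup (col v) i) xor total G⁻ p↓ v i
          ≡⟨ cong (λ c → (c ∧ lookup (col v) i) xor total G⁻ p↓ v i) (trans (Graph.sym G _ _) (not-adjacent v≢a v≢b)) ⟩
        total G⁻ p↓ v i
          ≡⟨ sum-cong-≗ (λ u → cong (λ r → adj G⁻ v u ∧ lookup r i)
               (override-other p⁻ a b p₁ q₁ (v≢a ∘ proj₁) (v≢b ∘ proj₁))) ⟩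
        total G⁻ p⁻ v i ∎

      odd : ∀ v → ∃[ i ] total G p v i ≡ true
      odd v with punchInView x v
      ... | hole    = proj₁ s⊕r′-odd , trans (total-x _) (proj₂ s⊕r′-odd)
      ... | punch v = proj₁ (odd⁻ v) , trans (total-≡ v _) (proj₂ (odd⁻ v))

      solution : Solution G t
      solution = record { φ = φ ; p = p ; realises = realises ; odd = odd }

    -- The option chosen from `E` lies in the larger gadget, so it decomposes into a choice for the
    -- old edge and an ear.
    insert-solution : E ⊆ inner t a b ⊞ triangle (t (punchIn x a) x) (t x (punchIn x b)) →
      Solution G t
    insert-solution E⊆ with realises-⊞ (realises-⊆ E⊆
      (realises-≡ (override-ab (inner t) a b E (flip E)) (realises⁻ a b a~b)))
    ... | _ , _ , _ , _ , r₁ , r₂ , p-split , q-split =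
      Insert.solution r₁ (realises-triangle r₂) p-split q-split

  solvable-ear : ∀ {Good} → GoodClass Good → Solvable Good G⁻ → Solvable Good G
  solvable-ear {Good} good solve t t-good t-sym
    -- The sides are read along the path `a`, `x`, `b`, as `triangle` expects.
    with absorb-good (t-good (punchIn x a) (punchIn x b)) (t-good (punchIn x a) x) (t-good x (punchIn x b))
    where open GoodClass good
  ... | E , E-good , E⊆ = insert-solution t-sym (solve t⁻ t⁻-good t⁻-sym) E⊆
    where
    open GoodClass good
    t⁻ : Fin n → Fin n → Gadget
    t⁻ = override (inner t) a b E (flip E)

    t⁻-good : ∀ u v → Good (t⁻ u v)
    t⁻-good u v with position a b u v
    ... | ab = subst Good (sym (override-ab (inner t) a b E (flip E))) E-good
    ... | ba = subst Good (sym (override-ba (inner t) a b E (flip E) a≢b)) (flip-good E-good)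
    ... | other ¬ab ¬ba =
      subst Good (sym (override-other (inner t) a b E (flip E) ¬ab ¬ba)) (t-good _ _)

    t⁻-sym : ∀ u v → t⁻ v u ≡ flip (t⁻ u v)
    t⁻-sym u v with position a b u v
    ... | ab = trans (override-ba (inner t) a b E (flip E) a≢b)
                 (cong flip (sym (override-ab (inner t) a b E (flip E))))
    ... | ba = trans (override-ab (inner t) a b E (flip E)) (trans (sym (flip-involutive E))
                 (cong flip (sym (override-ba (inner t) a b E (flip E) a≢b))))
    ... | other ¬ab ¬ba =
      trans (override-other (inner t) a b E (flip E)
              (λ (v≡a , u≡b) → ¬ba (u≡b , v≡a)) (λ (v≡b , u≡a) → ¬ab (u≡a , v≡b)))
        (trans (t-sym _ _) (cong flip (sym (override-other (inner t) a b E (flip E) ¬ab ¬ba))))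

-- Solvability of gadget problems on 2-trees.

module _ {Good : Gadget → Set} (good : GoodClass Good) where
  open GoodClass good

  solvable-K₂ : (G : Graph 2) → (∀ u v → u ≢ v → adj G u v ≡ true) → Solvable Good G
  solvable-K₂ G complete t t-good t-sym with odd-pair (t-good 0F 1F)
  ... | p , q , pq∈ , (i , p-odd) , (j , q-odd) = record
    { φ = φ ; p = r ; realises = realises ; odd = odd }
    where
    φ : Fin 2 → Fin 4
    φ 0F = 0F
    φ 1F = 1F
    -- Each vertex has one edge, so the chosen pair gives the two totals; the diagonal entries are
    -- masked.
    r : Fin 2 → Fin 2 → Parities
    r 0F _ = p
    r 1F _ = q
    realises₀₁ : Realises (t 0F 1F) 0F 1F p q
    realises₀₁ = realise Perm.id refl refl pq∈ (sym (tabulate∘lookup p)) (sym (tabulate∘lookup q))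
    realises : ∀ u v → adj G u v ≡ true → Realises (t u v) (φ u) (φ v) (r u v) (r v u)
    realises 0F 0F 0~0 with () ← trans (sym 0~0) (irrefl G 0F)
    realises 0F 1F _ = realises₀₁
    realises 1F 0F _ = realises-sym t-sym realises₀₁
    realises 1F 1F 1~1 with () ← trans (sym 1~1) (irrefl G 1F)
    odd : ∀ v → ∃[ i ] total G r v i ≡ true
    odd 0F = i , cong₂ _xor_ (cong (_∧ lookup p i) (irrefl G 0F))
      (cong₂ (λ c d → (c ∧ d) xor false) (complete 0F 1F λ ()) p-odd)
    odd 1F = j , cong₂ _xor_ (cong₂ _∧_ (complete 1F 0F λ ()) q-odd)
      (cong (λ c → (c ∧ lookup q j) xor false) (irrefl G 1F))

  solvable-twoTree : ∀ {n} {G : Graph n} → IsTwoTree G → Solvable Good G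
  solvable-twoTree {G = G} (base (refl , complete)) =
    solvable-ear G 2F {0F} {1F} (λ ())
      (complete 0F 1F λ ()) (complete 2F 0F λ ()) (complete 2F 1F λ ())
      (λ { 0F _ → inj₁ refl ; 1F _ → inj₂ refl }) good
      (solvable-K₂ (deleteVertex G 2F) λ u v u≢v → complete _ _ (u≢v ∘ punchIn-injective 2F u v))
  solvable-twoTree {G = G} (step x a b a≢b a~b x~a x~b x~ twoTree)
    with punchInView x a | punchInView x b
  -- There are no loops, so the neighbours `a` and `b` survive the deletion of `x`.
  ... | hole    | _       with () ← trans (sym x~a) (irrefl G x)
  ... | punch _ | hole    with () ← trans (sym x~b) (irrefl G x)
  ... | punch a | punch b = solvable-ear G x (a≢b ∘ cong (punchIn x)) a~b x~a x~b
    (λ u x~u → [ inj₁ ∘ punchIn-injective x u a , inj₂ ∘ punchIn-injective x u b ]′ (x~ _ x~u)) good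
    (solvable-twoTree twoTree)

-- From solutions for plain edges to odd colourings.

odd? : ℕ → Bool
odd? zero    = false
odd? (suc m) = not (odd? m)

odd?⇒Odd : ∀ m → odd? m ≡ true → Odd m
odd?⇒Odd (suc zero)    _  = refl
odd?⇒Odd (suc (suc m)) eq = odd?⇒Odd m (trans (sym (Boolₚ.not-involutive (odd? m))) eq)

odd?-length-filter : ∀ {n} {A : Set} {P : A → Set} (P? : Decidable P) (f : Fin n → A) →
  odd? (length (filter P? (List.tabulate f))) ≡ sum (λ u → does (P? (f u)))
odd?-length-filter {zero}  P? f = refl
odd?-length-filter {suc n} P? f with does (P? (f zero))
... | true  = trans (cong not (odd?-length-filter P? (f ∘ suc))) (sym (Boolₚ.true-xor _))
... | false = odd?-length-filter P? (f ∘ suc)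

-- A plain edge shows each end the colour of the other: the end coloured 0 sees colour 1, and
-- conversely.
single : Gadget
single = ⟨1⟩ ∣ ⟨0⟩ ∷ []

flip-single : flip single ≡ single
flip-single = refl

-- The only non-zero coordinate of `⟨1⟩` is 1, and by injectivity `τ` sends only `d` there.
realises-single : ∀ {c d p q} → Realises single c d p q → ∀ i → lookup p i ≡ does (d ≟ i)
realises-single {d = d} (realise τ _ d↦1 (here refl) refl _) i =
  trans (recolour-lookup τ ⟨1⟩ i) (trans (lookup-1 (τ ⟨$⟩ʳ i)) 1≟τi)
  where
  lookup-1 : ∀ j → lookup ⟨1⟩ j ≡ does (1F ≟ j)
  lookup-1 0F = refl
  lookup-1 1F = refl
  lookup-1 2F = refl
  lookup-1 3F = refl
  1≟τi : does (1F ≟ τ ⟨$⟩ʳ i) ≡ does (d ≟ i)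
  1≟τi with d ≟ i
  ... | yes refl = dec-true (1F ≟ τ ⟨$⟩ʳ d) (sym d↦1)
  ... | no d≢i   = dec-false (1F ≟ τ ⟨$⟩ʳ i) λ 1≡τi → d≢i
    (trans (sym (Perm.inverseˡ τ)) (trans (cong (τ ⟨$⟩ˡ_) (trans d↦1 1≡τi)) (Perm.inverseˡ τ)))

solution⇒odd4Colorable : ∀ {n} {G : Graph n} → Solution G (λ _ _ → single) → Odd4Colorable G
solution⇒odd4Colorable {n} {G} solution =
  φ , (λ u v u~v → realises-≢ (realises u v u~v)) , λ v _ → oddCondition v
  where
  open Solution solution
  -- Each neighbour contributes the indicator of its own colour, so the total is the neighbour count
  -- modulo 2.
  count : ∀ v i → odd? (nbrColorCount G φ v i) ≡ total G p v i
  count v i = trans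
    (odd?-length-filter (λ u → (adj G v u Bool.≟ true) ×-dec (φ u ≟ i)) (λ u → u))
    (sum-cong-≗ entry)
    where
    entry : ∀ u → does ((adj G v u Bool.≟ true) ×-dec (φ u ≟ i)) ≡ adj G v u ∧ lookup (p v u) i
    entry u with adj G v u in eq
    ... | false = refl
    ... | true  = sym (realises-single (realises v u eq) i)
  oddCondition : ∀ v → OddCondition G φ v
  oddCondition v = proj₁ (odd v) , odd?⇒Odd (nbrColorCount G φ v (proj₁ (odd v))) (trans (count v _) (proj₂ (odd v)))

goodClass⇒odd4Colorable : ∀ {Good} → GoodClass Good → Good single →
  ∀ {n} {G : Graph n} → IsTwoTree G → Odd4Colorable G
goodClass⇒odd4Colorable good single-good twoTree = solution⇒odd4Colorable
  (solvable-twoTree good twoTree (λ _ _ → single) (λ _ _ → single-good) (λ _ _ → sym flip-single))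

-- A finite good class.

withFlips : List Gadget → List Gadget
withFlips Es = Es ++ map flip Es

flip∈withFlips : ∀ Es {E} → E ∈ withFlips Es → flip E ∈ withFlips Es
flip∈withFlips Es E∈ with ∈-++⁻ Es E∈
... | inj₁ E∈Es = ∈-++⁺ʳ Es (∈-map⁺ flip E∈Es)
... | inj₂ E∈flips with ∈-map⁻ flip E∈flips
...   | F , F∈Es , refl = ∈-++⁺ˡ (subst (_∈ Es) (sym (flip-involutive F)) F∈Es)

-- Found by computer search: start from the gadgets generated by a plain edge
-- under absorption, and repeatedly replace members by proper subsets as long as
-- the generated list does not grow.
gadgetRepresentatives : List Gadget
gadgetRepresentatives =
  (⟨1⟩ ∣ ⟨0⟩ ∷ []) ∷
  (⟨12⟩ ∣ ⟨02⟩ ∷ ⟨13⟩ ∣ ⟨03⟩ ∷ []) ∷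
  (∅ ∣ ⟨0⟩ ∷ ⟨12⟩ ∣ ⟨2⟩ ∷ ⟨13⟩ ∣ ⟨3⟩ ∷ []) ∷
  (⟨1⟩ ∣ ⟨2⟩ ∷ ⟨1⟩ ∣ ⟨3⟩ ∷ ⟨1⟩ ∣ ⟨023⟩ ∷ []) ∷
  (∅ ∣ ⟨02⟩ ∷ ∅ ∣ ⟨03⟩ ∷ ⟨12⟩ ∣ ⟨03⟩ ∷ ⟨13⟩ ∣ ⟨02⟩ ∷ []) ∷
  (⟨1⟩ ∣ ⟨02⟩ ∷ ⟨1⟩ ∣ ⟨03⟩ ∷ ⟨123⟩ ∣ ⟨02⟩ ∷ ⟨123⟩ ∣ ⟨03⟩ ∷ []) ∷
  (⟨2⟩ ∣ ⟨02⟩ ∷ ⟨3⟩ ∣ ⟨03⟩ ∷ ⟨123⟩ ∣ ⟨02⟩ ∷ ⟨123⟩ ∣ ⟨03⟩ ∷ []) ∷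
  (⟨2⟩ ∣ ⟨023⟩ ∷ ⟨3⟩ ∣ ⟨023⟩ ∷ ⟨123⟩ ∣ ⟨2⟩ ∷ ⟨123⟩ ∣ ⟨3⟩ ∷ []) ∷
  (⟨12⟩ ∣ ⟨23⟩ ∷ ⟨13⟩ ∣ ⟨23⟩ ∷ ⟨23⟩ ∣ ⟨02⟩ ∷ ⟨23⟩ ∣ ⟨03⟩ ∷ []) ∷
  (∅ ∣ ⟨2⟩ ∷ ∅ ∣ ⟨3⟩ ∷ ⟨12⟩ ∣ ⟨2⟩ ∷ ⟨13⟩ ∣ ⟨3⟩ ∷ ⟨23⟩ ∣ ⟨023⟩ ∷ []) ∷
  (∅ ∣ ⟨023⟩ ∷ ⟨12⟩ ∣ ⟨3⟩ ∷ ⟨12⟩ ∣ ⟨023⟩ ∷ ⟨13⟩ ∣ ⟨2⟩ ∷ ⟨13⟩ ∣ ⟨023⟩ ∷ ⟨23⟩ ∣ ⟨2⟩ ∷ ⟨23⟩ ∣ ⟨3⟩ ∷ []) ∷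
  []

gadgets : List Gadget
gadgets = withFlips gadgetRepresentatives

-- Intermediate between triangle-link and link-absorb, so that absorption need
-- not be checked for all triples of gadgets.
linkRepresentatives : List Gadget
linkRepresentatives =
  (⟨2⟩ ∣ ⟨2⟩ ∷ ⟨3⟩ ∣ ⟨3⟩ ∷ []) ∷
  (∅ ∣ ⟨2⟩ ∷ ∅ ∣ ⟨3⟩ ∷ ⟨23⟩ ∣ ⟨2⟩ ∷ ⟨23⟩ ∣ ⟨3⟩ ∷ []) ∷
  (∅ ∣ ⟨02⟩ ∷ ∅ ∣ ⟨03⟩ ∷ ∅ ∣ ⟨23⟩ ∷ ⟨23⟩ ∣ ⟨23⟩ ∷ []) ∷
  (⟨2⟩ ∣ ⟨02⟩ ∷ ⟨2⟩ ∣ ⟨23⟩ ∷ ⟨3⟩ ∣ ⟨03⟩ ∷ ⟨3⟩ ∣ ⟨23⟩ ∷ []) ∷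
  (⟨2⟩ ∣ ⟨023⟩ ∷ ⟨3⟩ ∣ ⟨023⟩ ∷ ⟨123⟩ ∣ ⟨2⟩ ∷ ⟨123⟩ ∣ ⟨3⟩ ∷ []) ∷
  (⟨12⟩ ∣ ⟨23⟩ ∷ ⟨13⟩ ∣ ⟨23⟩ ∷ ⟨23⟩ ∣ ⟨02⟩ ∷ ⟨23⟩ ∣ ⟨03⟩ ∷ []) ∷
  (⟨1⟩ ∣ ⟨02⟩ ∷ ⟨1⟩ ∣ ⟨03⟩ ∷ ⟨2⟩ ∣ ⟨02⟩ ∷ ⟨3⟩ ∣ ⟨03⟩ ∷ ⟨123⟩ ∣ ⟨23⟩ ∷ []) ∷
  (⟨1⟩ ∣ ⟨2⟩ ∷ ⟨1⟩ ∣ ⟨3⟩ ∷ ⟨2⟩ ∣ ⟨3⟩ ∷ ⟨3⟩ ∣ ⟨2⟩ ∷ ⟨123⟩ ∣ ⟨2⟩ ∷ ⟨123⟩ ∣ ⟨3⟩ ∷ []) ∷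
  (⟨1⟩ ∣ ⟨23⟩ ∷ ⟨2⟩ ∣ ⟨03⟩ ∷ ⟨2⟩ ∣ ⟨23⟩ ∷ ⟨3⟩ ∣ ⟨02⟩ ∷ ⟨3⟩ ∣ ⟨23⟩ ∷ ⟨123⟩ ∣ ⟨02⟩ ∷ ⟨123⟩ ∣ ⟨03⟩ ∷ []) ∷
  []

links : List Gadget
links = withFlips linkRepresentatives

_≟ₚ_ : DecidableEquality (Parities × Parities)
_≟ₚ_ = ×-≡-dec (Vec-≡-dec Bool._≟_) (Vec-≡-dec Bool._≟_)

open DecMembership _≟ₚ_ using (_∈?_)

-- Unlike the library's version, this one computes `does` without evaluating proofs.
_⊆?_ : (E F : Gadget) → Dec (E ⊆ F)
E ⊆? F = map′ (λ E⊆F → All.lookup E⊆F) (λ E⊆F → All.tabulate E⊆F) (All.all? (_∈? F) E)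

containsOneOf? : ∀ F Es → Dec (Any (_⊆ F) Es)
containsOneOf? F = Any.any? (_⊆? F)

abstract
  -- Proved by evaluation, as is `link-absorb`: with 22 gadgets and 18 links there are 484 and 396
  -- pairs to check, against 10648 triples.
  triangle-link : All (λ E → All (λ F → Any (_⊆ triangle E F) links) gadgets) gadgets
  triangle-link = from-yes
    (All.all? (λ E → All.all? (λ F → containsOneOf? (triangle E F) links) gadgets) gadgets)

  link-absorb : All (λ E → All (λ T → Any (_⊆ E ⊞ T) gadgets) links) gadgets
  link-absorb = from-yes
    (All.all? (λ E → All.all? (λ T → containsOneOf? (E ⊞ T) gadgets) links) gadgets)

  gadget-odd-pair : All (Any (λ (p , q) → Odd∈ p × Odd∈ q)) gadgets
  gadget-odd-pair = from-yes
    (All.all? (Any.any? (λ (p , q) → odd∈? p ×-dec odd∈? q)) gadgets)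

-- Carries `link-absorb` over from a link to any triangle containing it.
⊞-monoʳ : ∀ E {T T′} → T ⊆ T′ → E ⊞ T ⊆ E ⊞ T′
⊞-monoʳ E {T} T⊆T′ pq∈ with ∈-cartesianProductWith⁻ _ E T pq∈
... | _ , _ , e∈E , t∈T , refl = ∈-cartesianProductWith⁺ _ e∈E (T⊆T′ t∈T)

gadgets-good : GoodClass (_∈ gadgets)
gadgets-good = record
  { flip-good   = flip∈withFlips gadgetRepresentatives
  ; absorb-good = absorb
  ; odd-pair    = oddPair
  }
  where
  absorb : ∀ {E F H} → E ∈ gadgets → F ∈ gadgets → H ∈ gadgets →
    ∃[ E′ ] E′ ∈ gadgets × E′ ⊆ E ⊞ triangle F H
  absorb {E} E∈ F∈ H∈ with find (All.lookup (All.lookup triangle-link F∈) H∈)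
  ... | T , T∈ , T⊆ with find (All.lookup (All.lookup link-absorb E∈) T∈)
  ... | E′ , E′∈ , E′⊆ = E′ , E′∈ , ⊞-monoʳ E T⊆ ∘ E′⊆
  oddPair : ∀ {E} → E ∈ gadgets → ∃₂ λ p q → (p , q) ∈ E × Odd∈ p × Odd∈ q
  oddPair E∈ with find (All.lookup gadget-odd-pair E∈)
  ... | (p , q) , pq∈ , p-odd , q-odd = p , q , pq∈ , p-odd , q-odd

theorem1p4 : ∀ (n : ℕ) (G : Graph n) → IsTwoTree G → Odd4Colorable G
-- `here refl` holds because the plain edge heads the list of gadgets.
theorem1p4 n G = goodClass⇒odd4Colorable gadgets-good (here refl)
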